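{- Let $G$ be a finite connected simple cubic graph that admits a minimal chordal sense of direction and is not isomorphic to $K_4$. Then $G$ has a $6$-cycle double cover.
   Context: All graphs are finite, connected, undirected, with no multiple edges or self-loops. A cubic graph is a $3$-regular graph. A cycle double cover (CDC) of a graph $G$ is a collection of cycles of $G$ such that every edge of $G$ belongs to exactly two of the cycles in the collection. A $6$-cycle double cover ($6$-CDC) is a CDC in which every cycle has length $6$. A chordal sense of direction on a graph $G$ with $n$ vertices is an edge labeling, assigning to each edge two labels (one for each of its end vertices), obtained as follows: fix a cyclic ordering of the vertices of $G$ (i.e. a bijection $r$ from $V(G)$ to $\mathbb{Z}_n$), and for each edge $uv$ let the label of $uv$ corresponding to $u$ be the rank difference from $u$ to $v$ modulo $n$, i.e. $r(v)-r(u) \bmod n$, and let the label of $uv$ corresponding to $v$ be $r(u)-r(v) \bmod n$. A chordal sense of direction is minimal if the total number of distinct labels used over the whole graph is exactly $\Delta(G)$, the maximum degree of $G$ (so exactly $3$ for a cubic graph). $G$ admits a minimal chordal sense of direction (MCSD) if some choice of cyclic ordering yields a minimal one. -}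

module Defs where

open import Data.Fin using (Fin; toℕ)
open import Data.Fin.Permutation using (Permutation; Permutation′; _⟨$⟩ʳ_)
import Data.Fin.Properties as Fin
open import Data.List using (List; length; filter; map; concatMap; allFin; deduplicate)
open import Data.List.Extrema.Nat using (max)
open import Data.List.Relation.Unary.All using (All)
open import Data.Nat using (ℕ; suc; _+_; _∸_; _≤_; NonZero)
open import Data.Nat.DivMod using (_mod_)
open import Data.Product using (Σ; ∃-syntax; _×_)
open import Data.Sum using (_⊎_)
open import Function.Bundles using (_⇔_)
open import Function.Definitions using (Injective)
open import Level using (0ℓ)
open import Relation.Binary.Core using (Rel)
open import Relation.Binary.Definitions using (Decidable; Irreflexive; Symmetric)
open import Relation.Binary.Construct.Closure.ReflexiveTransitive using (Star)
open import Relation.Binary.PropositionalEquality using (_≡_; _≢_; ≢-sym)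
open import Relation.Nullary using (Dec; ¬?)
open import Relation.Nullary.Decidable using (_×-dec_; _⊎-dec_)

record Graph (n : ℕ) : Set₁ where
  infix 4 _~_ _~?_
  field
    _~_    : Rel (Fin n) 0ℓ
    _~?_   : Decidable _~_
    sym    : Symmetric _~_
    irrefl : Irreflexive _≡_ _~_

  neighbours : Fin n → List (Fin n)
  neighbours u = filter (u ~?_) (allFin n)

  degree : Fin n → ℕ
  degree u = length (neighbours u)

  maxDegree : ℕ
  maxDegree = max 0 (map degree (allFin n))

Connected : ∀ {n} → Graph n → Set
Connected {n} G = NonZero n × (∀ u v → Star (Graph._~_ G) u v)

Cubic : ∀ {n} → Graph n → Set
Cubic G = ∀ u → Graph.degree G u ≡ 3

_≅_ : ∀ {m n} → Graph m → Graph n → Set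
_≅_ {m} {n} G H =
  Σ (Permutation m n) λ π → ∀ u v → (u G.~ v) ⇔ ((π ⟨$⟩ʳ u) H.~ (π ⟨$⟩ʳ v))
  where
  module G = Graph G
  module H = Graph H

K : ∀ n → Graph n
K n = record
  { _~_    = _≢_
  ; _~?_   = λ u v → ¬? (u Fin.≟ v)
  ; sym    = ≢-sym
  ; irrefl = λ u≡v u≢v → u≢v u≡v
  }

-- b - a in ℤ/n, whose elements are represented by Fin n.
difference : ∀ {n} → Fin n → Fin n → Fin n
difference {n} a b = _mod_ (toℕ b + (n ∸ toℕ a)) n {{Fin.nonZeroIndex a}}

module _ {n} (G : Graph n) where
  open Graph G

  -- The label of the edge uv at its end u.
  chordalLabel : Permutation′ n → Fin n → Fin n → Fin n
  chordalLabel r u v = difference (r ⟨$⟩ʳ u) (r ⟨$⟩ʳ v)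

  -- Every edge uv contributes twice: at u, and (as a neighbour of v) at v.
  allLabels : Permutation′ n → List (Fin n)
  allLabels r = concatMap (λ u → map (chordalLabel r u) (neighbours u)) (allFin n)

  numberOfLabels : Permutation′ n → ℕ
  numberOfLabels r = length (deduplicate Fin._≟_ (allLabels r))

  HasMCSD : Set
  HasMCSD = ∃[ r ] numberOfLabels r ≡ maxDegree

-- The cyclic successor i + 1 mod k.
next : ∀ {k} → Fin k → Fin k
next {k} i = _mod_ (suc (toℕ i)) k {{Fin.nonZeroIndex i}}

-- A cycle is presented by a cyclic enumeration of its vertices; membership of
-- edges, below, does not depend on the starting point or the direction.
record Cycle {n} (G : Graph n) : Set where
  open Graph G
  field
    len       : ℕ
    3≤len     : 3 ≤ len
    vertex    : Fin len → Fin n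
    injective : Injective _≡_ _≡_ vertex
    adjacent  : ∀ i → vertex i ~ vertex (next i)

module _ {n} {G : Graph n} where
  open Graph G

  EdgeIn : Fin n → Fin n → Cycle G → Set
  EdgeIn u v C = ∃[ i ] ((vertex i ≡ u × vertex (next i) ≡ v)
                       ⊎ (vertex i ≡ v × vertex (next i) ≡ u))
    where open Cycle C

  edgeIn? : ∀ u v C → Dec (EdgeIn u v C)
  edgeIn? u v C = Fin.any? λ i →
      (vertex i Fin.≟ u ×-dec vertex (next i) Fin.≟ v)
    ⊎-dec (vertex i Fin.≟ v ×-dec vertex (next i) Fin.≟ u)
    where open Cycle C

  -- The collection may a priori contain a cycle more than once.
  IsCDC : List (Cycle G) → Set
  IsCDC Cs = ∀ u v → u ~ v → length (filter (edgeIn? u v) Cs) ≡ 2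

Has6CDC : ∀ {n} → Graph n → Set
Has6CDC G = ∃[ Cs ] (IsCDC {G = G} Cs × All (λ C → Cycle.len C ≡ 6) Cs)

module Submission where

-- The three labels at a vertex are distinct, so minimality makes every vertex
-- carry the same three labels S = -S ∌ 0.  As ℤ/n has at most one involution,
-- S = {h, a, -a} with 2h = 0 and 2a ≠ 0, and G is the circulant graph of S.
-- Write α and η for the shifts by a and h.  If 2a ≠ h, the hexagons
--   x, αx, α²x, ηα²x, ηαx, ηx
-- form the cover, x ranging over representatives modulo η: up to η, the edge
-- {w, αw} lies in those of x = w and x = α⁻¹w, and {w, ηw} in those of x = w
-- and x = α⁻²w.  If 2a = h, every component of G has four vertices, so G ≅ K₄.

open import Algebra.Bundles using (AbelianGroup)
open import Algebra.Consequences.Propositional using (comm∧idˡ⇒id; comm∧invʳ⇒inv)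
import Algebra.Properties.AbelianGroup as GroupProperties
open import Data.Bool using (true; false)
open import Data.Fin using (Fin; toℕ)
open import Data.Fin.Patterns
import Data.Fin.Permutation as Perm
import Data.Fin.Properties as Fin
open import Data.List using (List; []; _∷_; _++_; length; filter; map; deduplicate; allFin)
open import Data.List.Extrema.Nat using (max≤v⁺; xs≤max)
open import Data.List.Membership.Propositional using (_∈_; _∉_; lose)
open import Data.List.Membership.Propositional.Properties
open import Data.List.Properties using (length-map; length-tabulate; length-++)
open import Data.List.Relation.Binary.Permutation.Propositional
  using (_↭_; prep; swap; ↭-refl; ↭-sym; ↭-trans)
open import Data.List.Relation.Binary.Permutation.Propositional.Properties using (∈-resp-↭)
open import Data.List.Relation.Binary.Subset.Propositional using (_⊆_)
open import Data.List.Relation.Unary.All as All using ([]; _∷_)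
import Data.List.Relation.Unary.All.Properties as All
open import Data.List.Relation.Unary.AllPairs using ([]; _∷_)
open import Data.List.Relation.Unary.Any using (here; there)
open import Data.List.Relation.Unary.Unique.DecPropositional.Properties using (deduplicate-!)
open import Data.List.Relation.Unary.Unique.Propositional using (Unique)
open import Data.List.Relation.Unary.Unique.Propositional.Properties using (filter⁺; allFin⁺; map⁺)
open import Data.Nat
  using (ℕ; suc; _+_; _*_; _∸_; _%_; _≤_; _<_; z≤n; s≤s; ⌊_/2⌋; NonZero; >-nonZero⁻¹)
open import Data.Nat.DivMod
open import Data.Nat.Divisibility using (divides; m%n≡0⇒n∣m)
import Data.Nat.Properties as ℕ
open import Data.Product using (∃-syntax; _×_; _,_; proj₂)
open import Data.Sum using (_⊎_; inj₁; inj₂; [_,_]′)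
import Data.Vec as Vec
import Data.Vec.Relation.Unary.All as VAll
import Data.Vec.Relation.Unary.AllPairs as VPairs
import Data.Vec.Relation.Unary.Unique.Propositional.Properties as VUnique
open import Function using (_∘_; _⇔_; mk⇔; Equivalence)
open import Level using (Level)
open import Relation.Binary.Construct.Closure.ReflexiveTransitive using (Star; ε; _◅_)
open import Relation.Binary.Definitions using (DecidableEquality; tri<; tri≈; tri>)
open import Relation.Binary.PropositionalEquality
  using (_≡_; _≢_; refl; sym; trans; cong; cong₂; subst; isEquivalence; module ≡-Reasoning)
open import Relation.Nullary using (¬_; Dec; yes; no; contradiction; does)
open import Relation.Unary using (Pred; Decidable)

open import Defs

-- Counting with duplicate-free lists.

private
  variable
    ℓ : Level
    A B : Set ℓ

-- Cut one occurrence of the head out of `ys`; the tail avoids the head, so it stays inside what is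
-- left.
Unique∧⊆⇒length≤ : {xs ys : List A} → Unique xs → xs ⊆ ys → length xs ≤ length ys
Unique∧⊆⇒length≤ [] xs⊆ys = z≤n
Unique∧⊆⇒length≤ {xs = x ∷ xs} (x∉xs ∷ uxs) xs⊆ys with ∈-∃++ (xs⊆ys (here refl))
... | as , bs , refl = begin
  suc (length xs)               ≤⟨ s≤s (Unique∧⊆⇒length≤ uxs remove) ⟩
  suc (length (as ++ bs))       ≡⟨ cong suc (length-++ as) ⟩
  suc (length as + length bs)   ≡⟨ ℕ.+-suc (length as) (length bs) ⟨
  length as + suc (length bs)   ≡⟨ length-++ as ⟨
  length (as ++ x ∷ bs)         ∎
  where
  open ℕ.≤-Reasoning
  remove : xs ⊆ as ++ bs
  remove z∈xs with ∈-++⁻ as (xs⊆ys (there z∈xs))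
  ... | inj₁ z∈as         = ∈-++⁺ˡ z∈as
  ... | inj₂ (here refl)  = contradiction refl (All.lookup x∉xs z∈xs)
  ... | inj₂ (there z∈bs) = ∈-++⁺ʳ as z∈bs

Unique⇒length≡ : {xs ys : List A} → Unique xs → Unique ys →
                 xs ⊆ ys → ys ⊆ xs → length xs ≡ length ys
Unique⇒length≡ uxs uys xs⊆ys ys⊆xs =
  ℕ.≤-antisym (Unique∧⊆⇒length≤ uxs xs⊆ys) (Unique∧⊆⇒length≤ uys ys⊆xs)

module _ (_≟_ : DecidableEquality A) where
  open import Data.List.Membership.DecPropositional _≟_ using (_∈?_)

  -- A missing `y` could be put in front of `xs`, giving a duplicate-free list inside `ys` that is
  -- longer than `ys`.
  Unique∧⊆∧length≥⇒⊇ : {xs ys : List A} → Unique xs → xs ⊆ ys →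
                        length ys ≤ length xs → ys ⊆ xs
  Unique∧⊆∧length≥⇒⊇ {xs} uxs xs⊆ys ys≤xs {y} y∈ys with y ∈? xs
  ... | yes y∈xs = y∈xs
  ... | no  y∉xs = contradiction
    (ℕ.≤-trans (Unique∧⊆⇒length≤ (All.¬Any⇒All¬ xs y∉xs ∷ uxs) y∷xs⊆ys) ys≤xs)
    (ℕ.<-irrefl refl)
    where
    y∷xs⊆ys : (y ∷ xs) ⊆ _
    y∷xs⊆ys (here refl)  = y∈ys
    y∷xs⊆ys (there z∈xs) = xs⊆ys z∈xs

length-filter-map : {P : Pred B ℓ} (P? : Decidable P) (f : A → B) (xs : List A) →
                    length (filter P? (map f xs)) ≡ length (filter (P? ∘ f) xs)
length-filter-map P? f []       = refl
length-filter-map P? f (x ∷ xs) with does (P? (f x))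
... | true  = cong suc (length-filter-map P? f xs)
... | false = length-filter-map P? f xs

-- Ladders: rails along a permutation `α`, rungs along a commuting involution `η`.

module Ladder {n} (G : Graph n)
  (α η : Fin n → Fin n)
  (α-injective  : ∀ {u v} → α u ≡ α v → u ≡ v)
  (α-surjective : ∀ v → ∃[ u ] α u ≡ v)
  (η-involutive : ∀ u → η (η u) ≡ u)
  (α∘η≗η∘α      : ∀ u → α (η u) ≡ η (α u))
  (α²u≢u : ∀ u → α (α u) ≢ u)
  (ηu≢u  : ∀ u → η u ≢ u)
  (αu≢ηu : ∀ u → α u ≢ η u)
  (adjacent⇔ : ∀ {u v} → Graph._~_ G u v ⇔ (v ≡ η u ⊎ v ≡ α u ⊎ u ≡ α v))
  where

  open Graph G using (_~_)

  η-injective : ∀ {u v} → η u ≡ η v → u ≡ v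
  η-injective {u} {v} ηu≡ηv = trans (sym (η-involutive u)) (trans (cong η ηu≡ηv) (η-involutive v))

  αu≢u : ∀ u → α u ≢ u
  αu≢u u αu≡u = α²u≢u u (trans (cong α αu≡u) αu≡u)

  ηswap : ∀ {u v} → u ≡ η v → v ≡ η u
  ηswap {v = v} refl = sym (η-involutive v)

  rail : ∀ u → u ~ α u
  rail u = Equivalence.from adjacent⇔ (inj₂ (inj₁ refl))

  rung : ∀ u → u ~ η u
  rung u = Equivalence.from adjacent⇔ (inj₁ refl)

  -- The degenerate case where `α` squares to `η`.

  module Collapsed (connected : ∀ u v → Star _~_ u v) (α²≗η : ∀ u → α (α u) ≡ η u) where

    orbit : Fin n → List (Fin n)
    orbit u = u ∷ α u ∷ α (α u) ∷ α (α (α u)) ∷ []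

    α⁴u≡u : ∀ u → α (α (α (α u))) ≡ u
    α⁴u≡u u = trans (α²≗η _) (trans (cong η (α²≗η u)) (η-involutive u))

    orbit-unique : ∀ u → Unique (orbit u)
    orbit-unique u =
        -- For the last entry: `u ≡ α (α (α u))` would give `α u ≡ u` after one more `α`.
        (αu≢u u ∘ sym ∷ α²u≢u u ∘ sym ∷ (λ e → αu≢u u (trans (cong α e) (α⁴u≡u u))) ∷ [])
      ∷ (αu≢u _ ∘ sym ∷ α²u≢u _ ∘ sym ∷ [])
      ∷ (αu≢u _ ∘ sym ∷ [])
      ∷ [] ∷ []

    orbit-α : ∀ {u v} → v ∈ orbit u → α v ∈ orbit u
    orbit-α (here refl)                         = there (here refl)
    orbit-α (there (here refl))                 = there (there (here refl))
    orbit-α (there (there (here refl)))         = there (there (there (here refl)))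
    orbit-α (there (there (there (here refl)))) = here (α⁴u≡u _)

    -- All three neighbours are powers of `α`: here `η` is the square of `α`, and the inverse of `α`
    -- is its cube.
    orbit-~ : ∀ {u v w} → v ∈ orbit u → v ~ w → w ∈ orbit u
    orbit-~ v∈ v~w with Equivalence.to adjacent⇔ v~w
    ... | inj₁ refl        = subst (_∈ _) (α²≗η _) (orbit-α (orbit-α v∈))
    ... | inj₂ (inj₁ refl) = orbit-α v∈
    ... | inj₂ (inj₂ refl) = subst (_∈ _) (α⁴u≡u _) (orbit-α (orbit-α (orbit-α v∈)))

    orbit-Star : ∀ {u v w} → v ∈ orbit u → Star _~_ v w → w ∈ orbit u
    orbit-Star v∈ ε          = v∈
    orbit-Star v∈ (v~x ◅ xw) = orbit-Star (orbit-~ v∈ v~x) xw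

    orbit-all : ∀ u v → v ∈ orbit u
    orbit-all u v = orbit-Star (here refl) (connected u v)

    n≡4 : Fin n → n ≡ 4
    n≡4 u = trans (sym (length-tabulate {n = n} (λ i → i)))
      (Unique⇒length≡ (allFin⁺ n) (orbit-unique u) (λ _ → orbit-all u _) (λ _ → ∈-allFin _))

    ≢⇒~ : ∀ {u v} → u ≢ v → u ~ v
    ≢⇒~ {u} {v} u≢v with orbit-all u v
    ... | here refl                         = contradiction refl u≢v
    ... | there (here refl)                 = rail u
    ... | there (there (here refl))         = subst (u ~_) (sym (α²≗η u)) (rung u)
    ... | there (there (there (here refl))) =
      Graph.sym G (subst (v ~_) (α⁴u≡u u) (rail v))

    ≅K4 : Fin n → G ≅ K 4
    ≅K4 u = ≅Kn (n≡4 u)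
      where
      -- With a variable `m` in place of 4, matching on `refl` identifies `m` with `n`, and the
      -- identity permutation serves.
      ≅Kn : ∀ {m} → n ≡ m → G ≅ K m
      ≅Kn refl = Perm.id , λ u v → mk⇔ (λ u~v u≡v → Graph.irrefl G u≡v u~v) ≢⇒~

  -- The generic case: hexagons in the ladder.

  module Proper (α²u≢ηu : ∀ u → α (α u) ≢ η u) where

    infix 4 _≈_
    _≈_ : Fin n → Fin n → Set
    u ≈ v = u ≡ v ⊎ u ≡ η v

    -- The boundary of two consecutive squares, with rungs at `x`, `α x` and `α (α x)`; the middle
    -- rung is a chord.
    hexagonVertices : Fin n → Vec.Vec (Fin n) 6
    hexagonVertices x = x ∷ α x ∷ α (α x) ∷ η (α (α x)) ∷ η (α x) ∷ η x ∷ []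
      where open Vec using ([]; _∷_)

    hexagon : Fin n → Cycle G
    hexagon x = record
      { len       = 6
      ; 3≤len     = s≤s (s≤s (s≤s z≤n))
      ; vertex    = Vec.lookup (hexagonVertices x)
      ; injective = VUnique.lookup-injective unique _ _
      ; adjacent  = λ where
          0F → rail x
          1F → rail (α x)
          2F → rung (α (α x))
          -- This edge and the next run against `α`, so each is a rail reversed.
          3F → Graph.sym G (subst (η (α x) ~_) (α∘η≗η∘α (α x)) (rail (η (α x))))
          4F → Graph.sym G (subst (η x ~_) (α∘η≗η∘α x) (rail (η x)))
          5F → Graph.sym G (rung x)
      }
      where
      open VAll using ([]; _∷_)
      open VPairs using ([]; _∷_)
      unique : VPairs.AllPairs _≢_ (hexagonVertices x)
      -- `α²u≢ηu` separates opposite corners: `x` from `η (α (α x))`, and `α (α x)` from `η x`.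
      unique =
          (αu≢u x ∘ sym ∷ α²u≢u x ∘ sym ∷ α²u≢ηu x ∘ ηswap ∷ αu≢ηu x ∘ ηswap ∷ ηu≢u x ∘ sym ∷ [])
        ∷ (αu≢u _ ∘ sym ∷ αu≢ηu (α x) ∘ ηswap ∷ ηu≢u _ ∘ sym ∷ αu≢ηu x ∷ [])
        ∷ (ηu≢u _ ∘ sym ∷ αu≢ηu (α x) ∷ α²u≢ηu x ∷ [])
        ∷ (αu≢u (α x) ∘ η-injective ∷ α²u≢u x ∘ η-injective ∷ [])
        ∷ (αu≢u x ∘ η-injective ∷ [])
        ∷ [] ∷ []

    -- Which hexagons contain a given edge.

    edgeIn-sym : ∀ {u v C} → EdgeIn {G = G} u v C → EdgeIn v u C
    edgeIn-sym (i , inj₁ e) = i , inj₂ e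
    edgeIn-sym (i , inj₂ e) = i , inj₁ e

    -- `α` and `η` disagree at every vertex, so no edge is both a rung and a rail; the disjuncts are
    -- the two orientations.
    rungs≢rails : ∀ {p q} → ¬ ((p ≡ q × η p ≡ α q) ⊎ (p ≡ α q × η p ≡ q))
    rungs≢rails (inj₁ (refl , ηp≡αp)) = αu≢ηu _ (sym ηp≡αp)
    rungs≢rails (inj₂ (refl , ηαq≡q)) = αu≢ηu _ (ηswap (sym ηαq≡q))

    -- `α` has no 2-cycle, so the ends of a rail determine its direction.
    rail-oriented : ∀ {p q} → p ≡ α q → α p ≢ q
    rail-oriented refl = α²u≢u _

    α²∘η≗η∘α² : ∀ u → α (α (η u)) ≡ η (α (α u))
    α²∘η≗η∘α² u = trans (cong α (α∘η≗η∘α u)) (α∘η≗η∘α (α u))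

    -- Only positions 2 and 5 of a hexagon are rungs, those at `α (α x)` and `x`. Placing the given
    -- rung at `α (α w)` avoids an inverse of `α`.
    rungIn⇔ : ∀ w x → EdgeIn (α (α w)) (η (α (α w))) (hexagon x) ⇔ (x ≈ α (α w) ⊎ x ≈ w)
    rungIn⇔ w x = mk⇔ to from
      where
      to : EdgeIn (α (α w)) (η (α (α w))) (hexagon x) → x ≈ α (α w) ⊎ x ≈ w
      to (0F , inj₁ (p , q)) = contradiction (inj₁ (sym p , sym q)) rungs≢rails
      to (0F , inj₂ (p , q)) = contradiction (inj₂ (sym q , sym p)) rungs≢rails
      to (1F , inj₁ (p , q)) = contradiction (inj₁ (sym p , sym q)) rungs≢rails
      to (1F , inj₂ (p , q)) = contradiction (inj₂ (sym q , sym p)) rungs≢rails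
      to (2F , inj₁ (p , _)) = inj₂ (inj₁ (α-injective (α-injective p)))
      to (2F , inj₂ (p , _)) = inj₂ (inj₂ (α-injective (α-injective (trans p (sym (α²∘η≗η∘α² w))))))
      -- Positions 3 and 4 lie on the far rail; `η` carries the match over to the rail of `x`.
      to (3F , inj₁ (p , q)) = contradiction (inj₁ (sym (η-injective q) , sym (ηswap (sym p)))) rungs≢rails
      to (3F , inj₂ (p , q)) = contradiction (inj₂ (sym (η-injective p) , sym (ηswap (sym q)))) rungs≢rails
      to (4F , inj₁ (p , q)) = contradiction (inj₁ (sym (η-injective q) , sym (ηswap (sym p)))) rungs≢rails
      to (4F , inj₂ (p , q)) = contradiction (inj₂ (sym (η-injective p) , sym (ηswap (sym q)))) rungs≢rails
      to (5F , inj₁ (_ , q)) = inj₁ (inj₂ q)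
      to (5F , inj₂ (_ , q)) = inj₁ (inj₁ q)

      from : x ≈ α (α w) ⊎ x ≈ w → EdgeIn (α (α w)) (η (α (α w))) (hexagon x)
      from (inj₁ (inj₁ refl)) = 5F , inj₂ (refl , refl)
      from (inj₁ (inj₂ refl)) = 5F , inj₁ (η-involutive _ , refl)
      from (inj₂ (inj₁ refl)) = 2F , inj₁ (refl , refl)
      from (inj₂ (inj₂ refl)) = 2F , inj₂ (α²∘η≗η∘α² w , sym (ηswap (α²∘η≗η∘α² w)))

    -- Up to `η`, the rails of the hexagon start at `x` and at `α x`; matching these starts with
    -- `α w` gives the two alternatives.
    railIn⇔ : ∀ w x → EdgeIn (α w) (α (α w)) (hexagon x) ⇔ (x ≈ α w ⊎ x ≈ w)
    railIn⇔ w x = mk⇔ to from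
      where
      to : EdgeIn (α w) (α (α w)) (hexagon x) → x ≈ α w ⊎ x ≈ w
      to (0F , inj₁ (p , _)) = inj₁ (inj₁ p)
      to (0F , inj₂ (p , q)) = contradiction q (rail-oriented p)
      to (1F , inj₁ (p , _)) = inj₂ (inj₁ (α-injective p))
      to (1F , inj₂ (p , q)) = contradiction q (rail-oriented p)
      to (2F , inj₁ (p , q)) = contradiction (inj₁ (p , q)) rungs≢rails
      to (2F , inj₂ (p , q)) = contradiction (inj₂ (p , q)) rungs≢rails
      -- On the far rail the hexagon runs against `α`, so now the forward match is the impossible
      -- one.
      to (3F , inj₁ (p , q)) = contradiction (trans (α∘η≗η∘α _) p) (rail-oriented q)
      to (3F , inj₂ (_ , q)) = inj₂ (inj₂ (ηswap (sym (α-injective (trans (α∘η≗η∘α x) q)))))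
      to (4F , inj₁ (p , q)) = contradiction (trans (α∘η≗η∘α _) p) (rail-oriented q)
      to (4F , inj₂ (_ , q)) = inj₁ (inj₂ (ηswap (sym q)))
      to (5F , inj₁ (p , q)) = contradiction (inj₂ (q , p)) rungs≢rails
      to (5F , inj₂ (p , q)) = contradiction (inj₁ (q , p)) rungs≢rails

      from : x ≈ α w ⊎ x ≈ w → EdgeIn (α w) (α (α w)) (hexagon x)
      from (inj₁ (inj₁ refl)) = 0F , inj₁ (refl , refl)
      from (inj₁ (inj₂ refl)) = 4F , inj₂ (sym (ηswap (α∘η≗η∘α (α w))) , η-involutive _)
      from (inj₂ (inj₁ refl)) = 1F , inj₁ (refl , refl)
      from (inj₂ (inj₂ refl)) = 3F , inj₂ (sym (ηswap (α²∘η≗η∘α² w)) , sym (ηswap (α∘η≗η∘α w)))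

    -- The hexagons at x and η x coincide, so x ranges over one vertex of each rung.
    Representative : Fin n → Set
    Representative x = toℕ x < toℕ (η x)

    representative? : Decidable Representative
    representative? x = toℕ x ℕ.<? toℕ (η x)

    -- Take the end of the rung with the smaller index; the ends differ because `η` has no fixed
    -- point.
    representative : ∀ u → ∃[ x ] (Representative x × x ≈ u)
    representative u with ℕ.<-cmp (toℕ u) (toℕ (η u))
    ... | tri< u<ηu _ _ = u , u<ηu , inj₁ refl
    ... | tri≈ _ u≡ηu _ = contradiction (sym (Fin.toℕ-injective u≡ηu)) (ηu≢u u)
    ... | tri> _ _ ηu<u = η u , subst (λ v → toℕ (η u) < toℕ v) (sym (η-involutive u)) ηu<u , inj₂ refl

    representative-unique : ∀ {x y} → Representative x → Representative y → x ≈ y → x ≡ y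
    representative-unique rx ry (inj₁ x≡y) = x≡y
    representative-unique {y = y} rx ry (inj₂ refl) =
      contradiction ry (ℕ.<-asym (subst (λ v → toℕ (η y) < toℕ v) (η-involutive y) rx))

    ≈-sym : ∀ {u v} → u ≈ v → v ≈ u
    ≈-sym (inj₁ refl) = inj₁ refl
    ≈-sym (inj₂ u≡ηv) = inj₂ (ηswap u≡ηv)

    ≈-trans : ∀ {u v w} → u ≈ v → v ≈ w → u ≈ w
    ≈-trans (inj₁ refl) v≈w         = v≈w
    ≈-trans (inj₂ refl) (inj₁ refl) = inj₂ refl
    ≈-trans (inj₂ refl) (inj₂ refl) = inj₁ (η-involutive _)

    -- The hexagons at the representatives form the cover.

    representatives : List (Fin n)
    representatives = filter representative? (allFin n)

    hexagons : List (Cycle G)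
    hexagons = map hexagon representatives

    -- The classes of `p` and `q` are distinct and have one representative each, so the list counted
    -- has the same members as `p′ ∷ q′ ∷ []`.
    covered-twice : ∀ {u v p q} → ¬ p ≈ q → (∀ x → EdgeIn u v (hexagon x) ⇔ (x ≈ p ⊎ x ≈ q)) →
                    length (filter (edgeIn? u v) hexagons) ≡ 2
    covered-twice {u} {v} {p} {q} p≉q edgeIn⇔
      with p′ , rp , p′≈p ← representative p | q′ , rq , q′≈q ← representative q =
      trans (length-filter-map (edgeIn? u v) hexagon representatives)
        (Unique⇒length≡ (filter⁺ _ (filter⁺ _ (allFin⁺ n))) ((p′≢q′ ∷ []) ∷ [] ∷ []) to from)
      where
      p′≢q′ : p′ ≢ q′
      p′≢q′ refl = p≉q (≈-trans (≈-sym p′≈p) q′≈q)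

      to : filter (edgeIn? u v ∘ hexagon) representatives ⊆ p′ ∷ q′ ∷ []
      to {x} x∈ with x∈reps , e ← ∈-filter⁻ (edgeIn? u v ∘ hexagon) x∈
                with _ , rx ← ∈-filter⁻ representative? {xs = allFin n} x∈reps
                with Equivalence.to (edgeIn⇔ x) e
      ... | inj₁ x≈p = here (representative-unique rx rp (≈-trans x≈p (≈-sym p′≈p)))
      ... | inj₂ x≈q = there (here (representative-unique rx rq (≈-trans x≈q (≈-sym q′≈q))))

      from : p′ ∷ q′ ∷ [] ⊆ filter (edgeIn? u v ∘ hexagon) representatives
      from (here refl) = ∈-filter⁺ (edgeIn? u v ∘ hexagon)
        (∈-filter⁺ representative? (∈-allFin p′) rp) (Equivalence.from (edgeIn⇔ p′) (inj₁ p′≈p))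
      from (there (here refl)) = ∈-filter⁺ (edgeIn? u v ∘ hexagon)
        (∈-filter⁺ representative? (∈-allFin q′) rq) (Equivalence.from (edgeIn⇔ q′) (inj₂ q′≈q))

    rung-covered : ∀ u → length (filter (edgeIn? u (η u)) hexagons) ≡ 2
    -- Pulling `u` back along `α` twice gives it the form that `rungIn⇔` expects.
    rung-covered u with t , refl ← α-surjective u with w , refl ← α-surjective t =
      covered-twice [ α²u≢u w , α²u≢ηu w ]′ (rungIn⇔ w)

    rail≉ : ∀ {w} → ¬ α w ≈ w
    rail≉ = [ αu≢u _ , αu≢ηu _ ]′

    hexagons-CDC : IsCDC hexagons
    hexagons-CDC u v u~v with Equivalence.to adjacent⇔ u~v
    ... | inj₁ refl = rung-covered u
    ... | inj₂ (inj₁ refl) with w , refl ← α-surjective u = covered-twice rail≉ (railIn⇔ w)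
    -- A rail traversed against `α`: the previous case with the ends exchanged.
    ... | inj₂ (inj₂ refl) with w , refl ← α-surjective v =
      covered-twice rail≉ λ x → mk⇔
        (Equivalence.to (railIn⇔ w x) ∘ edgeIn-sym {C = hexagon x})
        (edgeIn-sym {C = hexagon x} ∘ Equivalence.from (railIn⇔ w x))

    has6CDC : Has6CDC G
    has6CDC = hexagons , hexagons-CDC , All.map⁺ (All.tabulate (λ _ → refl))

-- Arithmetic of ℤ/n on `Fin n`.

module CyclicGroup (n : ℕ) .{{_ : NonZero n}} where

  infixl 6 _⊕_
  _⊕_ : Fin n → Fin n → Fin n
  x ⊕ y = (toℕ x + toℕ y) mod n

  0# : Fin n
  0# = 0 mod n

  ⊖_ : Fin n → Fin n
  ⊖ x = (n ∸ toℕ x) mod n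

  toℕ-mod : ∀ m → toℕ (m mod n) ≡ m % n
  toℕ-mod m = Fin.toℕ-fromℕ< (m%n<n m n)

  0%n≡0 : 0 % n ≡ 0
  0%n≡0 = m<n⇒m%n≡m (>-nonZero⁻¹ n)

  mod-cong : ∀ {k m} → k % n ≡ m % n → k mod n ≡ m mod n
  mod-cong {k} {m} eq = Fin.toℕ-injective (trans (toℕ-mod k) (trans eq (sym (toℕ-mod m))))

  toℕ-% : ∀ (x : Fin n) → toℕ x % n ≡ toℕ x
  toℕ-% x = m<n⇒m%n≡m (Fin.toℕ<n x)

  mod-toℕ : ∀ x → toℕ x mod n ≡ x
  mod-toℕ x = Fin.toℕ-injective (trans (toℕ-mod (toℕ x)) (toℕ-% x))

  -- Associativity, identity and inverses all rest on this freedom to reduce a summand early.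
  mod-+ : ∀ k m → (toℕ (k mod n) + m) mod n ≡ (k + m) mod n
  mod-+ k m = mod-cong (begin
    (toℕ (k mod n) + m) % n ≡⟨ cong (λ i → (i + m) % n) (toℕ-mod k) ⟩
    (k % n + m) % n         ≡⟨ %-distribˡ-+ (k % n) m n ⟩
    (k % n % n + m % n) % n ≡⟨ cong (λ i → (i + m % n) % n) (m%n%n≡m%n k n) ⟩
    (k % n + m % n) % n     ≡⟨ %-distribˡ-+ k m n ⟨
    (k + m) % n             ∎)
    where open ≡-Reasoning

  ⊕-comm : ∀ x y → x ⊕ y ≡ y ⊕ x
  ⊕-comm x y = cong (_mod n) (ℕ.+-comm (toℕ x) (toℕ y))

  ⊕-mod : ∀ x m → x ⊕ (m mod n) ≡ (toℕ x + m) mod n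
  ⊕-mod x m = begin
    x ⊕ (m mod n)       ≡⟨ ⊕-comm x (m mod n) ⟩
    (m mod n) ⊕ x       ≡⟨ mod-+ m (toℕ x) ⟩
    (m + toℕ x) mod n   ≡⟨ cong (_mod n) (ℕ.+-comm m (toℕ x)) ⟩
    (toℕ x + m) mod n   ∎
    where open ≡-Reasoning

  ⊕-assoc : ∀ x y z → (x ⊕ y) ⊕ z ≡ x ⊕ (y ⊕ z)
  ⊕-assoc x y z = begin
    (x ⊕ y) ⊕ z                        ≡⟨ mod-+ (toℕ x + toℕ y) (toℕ z) ⟩
    (toℕ x + toℕ y + toℕ z) mod n      ≡⟨ cong (_mod n) (ℕ.+-assoc (toℕ x) (toℕ y) (toℕ z)) ⟩
    (toℕ x + (toℕ y + toℕ z)) mod n    ≡⟨ ⊕-mod x (toℕ y + toℕ z) ⟨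
    x ⊕ (y ⊕ z)                        ∎
    where open ≡-Reasoning

  ⊕-identityˡ : ∀ x → 0# ⊕ x ≡ x
  ⊕-identityˡ x = trans (mod-+ 0 (toℕ x)) (mod-toℕ x)

  ⊕-inverseʳ : ∀ x → x ⊕ (⊖ x) ≡ 0#
  ⊕-inverseʳ x = begin
    x ⊕ (⊖ x)                   ≡⟨ ⊕-mod x (n ∸ toℕ x) ⟩
    (toℕ x + (n ∸ toℕ x)) mod n ≡⟨ cong (_mod n) (ℕ.m+[n∸m]≡n (ℕ.<⇒≤ (Fin.toℕ<n x))) ⟩
    n mod n                     ≡⟨ mod-cong (trans (n%n≡0 n) (sym 0%n≡0)) ⟩
    0#                          ∎
    where open ≡-Reasoning

  ℤ/n : AbelianGroup _ _
  ℤ/n = record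
    { Carrier = Fin n
    ; _≈_     = _≡_
    ; _∙_     = _⊕_
    ; ε       = 0#
    ; _⁻¹     = ⊖_
    ; isAbelianGroup = record
      { isGroup = record
        { isMonoid = record
          { isSemigroup = record
            { isMagma = record { isEquivalence = isEquivalence ; ∙-cong = cong₂ _⊕_ }
            ; assoc   = ⊕-assoc
            }
          ; identity = comm∧idˡ⇒id ⊕-comm ⊕-identityˡ
          }
        ; inverse = comm∧invʳ⇒inv ⊕-comm ⊕-inverseʳ
        ; ⁻¹-cong = cong ⊖_
        }
      ; comm = ⊕-comm
      }
    }

  difference≡ : ∀ x y → difference x y ≡ y ⊕ (⊖ x)
  difference≡ x y = sym (⊕-mod y (n ∸ toℕ x))

  -- `n` divides `toℕ x + toℕ x`, which is below `n + n`, so the quotient is 0 or 1; quotient 0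
  -- would make `x` zero.
  double≡n : ∀ x → x ≢ 0# → ⊖ x ≡ x → toℕ x + toℕ x ≡ n
  double≡n x x≢0 ⊖x≡x with m%n≡0⇒n∣m (toℕ x + toℕ x) n (begin
      (toℕ x + toℕ x) % n ≡⟨ toℕ-mod _ ⟨
      toℕ (x ⊕ x)         ≡⟨ cong (λ y → toℕ (x ⊕ y)) ⊖x≡x ⟨
      toℕ (x ⊕ (⊖ x))     ≡⟨ cong toℕ (⊕-inverseʳ x) ⟩
      toℕ 0#              ≡⟨ trans (toℕ-mod 0) 0%n≡0 ⟩
      0                   ∎)
    where open ≡-Reasoning
  ... | divides 0 eq = contradiction
    (trans (sym (mod-toℕ x)) (cong (_mod n) (ℕ.m+n≡0⇒m≡0 (toℕ x) eq))) x≢0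
  ... | divides 1 eq = trans eq (ℕ.+-identityʳ n)
  ... | divides (suc (suc k)) eq = contradiction eq (ℕ.<⇒≢ (begin-strict
      toℕ x + toℕ x   <⟨ ℕ.+-mono-< (Fin.toℕ<n x) (Fin.toℕ<n x) ⟩
      n + n           ≤⟨ ℕ.+-monoʳ-≤ n (ℕ.m≤m+n n (k * n)) ⟩
      n + (n + k * n) ∎))
    where open ℕ.≤-Reasoning

  -- Both elements double to `n` as natural numbers, so both are its half.
  involution-unique : ∀ {x y} → x ≢ 0# → y ≢ 0# → ⊖ x ≡ x → ⊖ y ≡ y → x ≡ y
  involution-unique {x} {y} x≢0 y≢0 ⊖x≡x ⊖y≡y = Fin.toℕ-injective (begin
    toℕ x                   ≡⟨ ℕ.n≡⌊n+n/2⌋ (toℕ x) ⟩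
    ⌊ toℕ x + toℕ x /2⌋     ≡⟨ cong ⌊_/2⌋ (double≡n x x≢0 ⊖x≡x) ⟩
    ⌊ n /2⌋                 ≡⟨ cong ⌊_/2⌋ (double≡n y y≢0 ⊖y≡y) ⟨
    ⌊ toℕ y + toℕ y /2⌋     ≡⟨ ℕ.n≡⌊n+n/2⌋ (toℕ y) ⟨
    toℕ y                   ∎)
    where open ≡-Reasoning

  -- Three-element subsets of ℤ/n closed under negation.

  open GroupProperties ℤ/n using (⁻¹-involutive; ⁻¹-injective)

  record IsChordalTriple (S : List (Fin n)) (h a : Fin n) : Set where
    field
      ⊖h≡h : ⊖ h ≡ h
      ⊖a≢a : ⊖ a ≢ a
      h≢a  : h ≢ a
      S↭   : S ↭ h ∷ a ∷ ⊖ a ∷ []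

  -- Negation permutes S, so it fixes one or three elements of S; three is too
  -- many because ℤ/n has at most one involution.
  chordalTriple : ∀ {S} → Unique S → length S ≡ 3 → 0# ∉ S → (∀ {s} → s ∈ S → ⊖ s ∈ S) →
                  ∃[ h ] ∃[ a ] IsChordalTriple S h a
  chordalTriple {x ∷ y ∷ z ∷ []} ((x≢y ∷ x≢z ∷ []) ∷ (y≢z ∷ []) ∷ [] ∷ []) refl 0∉S ⊖-closed = triple
    where
    S = x ∷ y ∷ z ∷ []

    fixed-pair : ∀ {h a b} → h ≢ a → a ≢ b → ⊖ h ≡ h → ⊖ a ≡ b → S ↭ h ∷ a ∷ b ∷ [] →
                 ∃[ h ] ∃[ a ] IsChordalTriple S h a
    fixed-pair {h} {a} h≢a a≢b ⊖h≡h refl S↭ = h , a , record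
      { ⊖h≡h = ⊖h≡h ; ⊖a≢a = a≢b ∘ sym ; h≢a = h≢a ; S↭ = S↭ }

    ⊖-swap : ∀ {s t} → ⊖ s ≡ t → ⊖ t ≡ s
    ⊖-swap {s} refl = ⁻¹-involutive s

    ≢0 : ∀ {s} → s ∈ S → s ≢ 0#
    ≢0 s∈S refl = 0∉S s∈S

    triple : ∃[ h ] ∃[ a ] IsChordalTriple S h a
    -- Impossible branches have two elements with the same negative, two fixed elements, or an
    -- element not recovered by negating twice.
    triple with ⊖-closed (here refl) | ⊖-closed (there (here refl)) | ⊖-closed (there (there (here refl)))
    ... | here ⊖x≡x | here ⊖y≡x | _ = contradiction (⁻¹-injective (trans ⊖x≡x (sym ⊖y≡x))) x≢y
    ... | here ⊖x≡x | there (here ⊖y≡y) | _ =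
      contradiction (involution-unique (≢0 (here refl)) (≢0 (there (here refl))) ⊖x≡x ⊖y≡y) x≢y
    ... | here ⊖x≡x | there (there (here ⊖y≡z)) | _ = fixed-pair x≢y y≢z ⊖x≡x ⊖y≡z ↭-refl
    ... | there (here ⊖x≡y) | _ | here ⊖z≡x = contradiction (trans (sym ⊖x≡y) (⊖-swap ⊖z≡x)) y≢z
    ... | there (here ⊖x≡y) | _ | there (here ⊖z≡y) =
      contradiction (⁻¹-injective (trans ⊖x≡y (sym ⊖z≡y))) x≢z
    ... | there (here ⊖x≡y) | _ | there (there (here ⊖z≡z)) =
      fixed-pair (x≢z ∘ sym) x≢y ⊖z≡z ⊖x≡y (↭-trans (prep x (swap y z ↭-refl)) (swap x z ↭-refl))
    ... | there (there (here ⊖x≡z)) | here ⊖y≡x | _ = contradiction (trans (sym (⊖-swap ⊖y≡x)) ⊖x≡z) y≢z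
    ... | there (there (here ⊖x≡z)) | there (here ⊖y≡y) | _ =
      fixed-pair (x≢y ∘ sym) x≢z ⊖y≡y ⊖x≡z (swap x y ↭-refl)
    ... | there (there (here ⊖x≡z)) | there (there (here ⊖y≡z)) | _ =
      contradiction (⁻¹-injective (trans ⊖x≡z (sym ⊖y≡z))) x≢y

-- Minimality makes `G` a circulant graph.

module Labels {n} (G : Graph n) .{{_ : NonZero n}} (cubic : Cubic G)
  (r : Perm.Permutation′ n) (minimal : numberOfLabels G r ≡ Graph.maxDegree G) where

  open Graph G using (_~_; _~?_; neighbours; degree; maxDegree)

  open CyclicGroup n
  open AbelianGroup ℤ/n using (_-_; identityʳ; inverseˡ; inverseʳ)
  open GroupProperties ℤ/n

  rank : Fin n → Fin n
  rank = r Perm.⟨$⟩ʳ_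

  rank-injective : ∀ {u v} → rank u ≡ rank v → u ≡ v
  rank-injective {u} {v} eq = trans (sym (Perm.inverseˡ r)) (trans (cong (r Perm.⟨$⟩ˡ_) eq) (Perm.inverseˡ r))

  label : Fin n → Fin n → Fin n
  label = chordalLabel G r

  label≡ : ∀ u v → label u v ≡ rank v - rank u
  label≡ u v = difference≡ (rank u) (rank v)

  label-injective : ∀ u {v w} → label u v ≡ label u w → v ≡ w
  label-injective u {v} {w} eq = rank-injective
    (∙-cancelʳ (⊖ rank u) _ _ (trans (sym (label≡ u v)) (trans eq (label≡ u w))))

  label-sym : ∀ u v → label v u ≡ ⊖ label u v
  label-sym u v = trans (label≡ v u) (trans (sym (⁻¹-anti-homo‿- _ _)) (cong ⊖_ (sym (label≡ u v))))

  -- Translation by `s` in ℤ/n, transported to the vertices along `r`.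
  shift : Fin n → Fin n → Fin n
  shift s u = r Perm.⟨$⟩ˡ (rank u ⊕ s)

  rank-shift : ∀ s u → rank (shift s u) ≡ rank u ⊕ s
  rank-shift s u = Perm.inverseʳ r

  label-shift : ∀ s u → label u (shift s u) ≡ s
  label-shift s u = begin
    label u (shift s u)       ≡⟨ label≡ u (shift s u) ⟩
    rank (shift s u) - rank u ≡⟨ cong (_- rank u) (rank-shift s u) ⟩
    rank u ⊕ s - rank u       ≡⟨ xyx⁻¹≈y (rank u) s ⟩
    s                         ∎
    where open ≡-Reasoning

  label⇒shift : ∀ {s u v} → label u v ≡ s → v ≡ shift s u
  label⇒shift {s} {u} eq = label-injective u (trans eq (sym (label-shift s u)))

  labels : List (Fin n)
  labels = deduplicate Fin._≟_ (allLabels G r)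

  maxDegree≡3 : maxDegree ≡ 3
  maxDegree≡3 = ℕ.≤-antisym
    (max≤v⁺ {xs = map degree (allFin n)} z≤n (All.map⁺ (All.tabulate (λ {u} _ → ℕ.≤-reflexive (cubic u)))))
    -- The lower bound takes one vertex; `0#` serves, as `n` is nonzero.
    (subst (_≤ maxDegree) (cubic 0#) (All.lookup (xs≤max 0 _) (∈-map⁺ degree (∈-allFin 0#))))

  label∈labels : ∀ {u v} → u ~ v → label u v ∈ labels
  label∈labels {u} {v} u~v = ∈-deduplicate⁺ Fin._≟_ (∈-concatMap⁺ _ (lose (∈-allFin u)
    (∈-map⁺ (label u) (∈-filter⁺ (u ~?_) (∈-allFin v) u~v))))

  -- The three neighbours of `u` have distinct labels, and `labels` has only three elements by
  -- minimality. So every label occurs at `u` on an edge, and injectivity identifies its other end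
  -- with `v`.
  label∈labels⇒~ : ∀ {u v} → label u v ∈ labels → u ~ v
  label∈labels⇒~ {u} {v} l∈ with ∈-map⁻ (label u) (labels⊆ l∈)
    where
    labels⊆ : labels ⊆ map (label u) (neighbours u)
    labels⊆ = Unique∧⊆∧length≥⇒⊇ Fin._≟_
      (map⁺ (label-injective u) (filter⁺ (u ~?_) (allFin⁺ n)))
      (λ s∈ → let _ , w∈ , eq = ∈-map⁻ (label u) s∈
              in subst (_∈ labels) (sym eq) (label∈labels (proj₂ (∈-filter⁻ (u ~?_) {xs = allFin n} w∈))))
      (ℕ.≤-reflexive (trans minimal (trans maxDegree≡3
        (sym (trans (length-map (label u) (neighbours u)) (cubic u))))))
  ... | w , w∈ , eq with refl ← label-injective u eq = proj₂ (∈-filter⁻ (u ~?_) {xs = allFin n} w∈)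

  shift-~ : ∀ {s} → s ∈ labels → ∀ u → u ~ shift s u
  shift-~ {s} s∈ u = label∈labels⇒~ (subst (_∈ labels) (sym (label-shift s u)) s∈)

  -- An edge with label `s` at one end has label `⊖ s` at the other.
  labels-⊖ : ∀ {s} → s ∈ labels → ⊖ s ∈ labels
  labels-⊖ {s} s∈ = subst (_∈ labels)
    (trans (label-sym 0# (shift s 0#)) (cong ⊖_ (label-shift s 0#)))
    (label∈labels (Graph.sym G (shift-~ s∈ 0#)))

  shift-shift : ∀ s t u → shift s (shift t u) ≡ shift (t ⊕ s) u
  shift-shift s t u = cong (r Perm.⟨$⟩ˡ_) (trans (cong (_⊕ s) (rank-shift t u)) (⊕-assoc (rank u) t s))

  shift-0 : ∀ u → shift 0# u ≡ u
  shift-0 u = trans (cong (r Perm.⟨$⟩ˡ_) (identityʳ (rank u))) (Perm.inverseˡ r)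

  shift-injectiveˡ : ∀ {s t u} → shift s u ≡ shift t u → s ≡ t
  shift-injectiveˡ {s} {t} {u} eq = trans (sym (label-shift s u)) (trans (cong (label u) eq) (label-shift t u))

  shift-fixed : ∀ {s u} → shift s u ≡ u → s ≡ 0#
  shift-fixed eq = shift-injectiveˡ (trans eq (sym (shift-0 _)))

  0∉labels : 0# ∉ labels
  0∉labels 0∈ = Graph.irrefl G (sym (shift-0 0#)) (shift-~ 0∈ 0#)

  shift-inverseˡ : ∀ s u → shift (⊖ s) (shift s u) ≡ u
  shift-inverseˡ s u = trans (shift-shift (⊖ s) s u) (trans (cong (λ t → shift t u) (inverseʳ s)) (shift-0 u))

  shift-inverseʳ : ∀ s u → shift s (shift (⊖ s) u) ≡ u
  shift-inverseʳ s u = trans (shift-shift s (⊖ s) u) (trans (cong (λ t → shift t u) (inverseˡ s)) (shift-0 u))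

  shift-injective : ∀ s {u v} → shift s u ≡ shift s v → u ≡ v
  shift-injective s {u} {v} eq =
    trans (sym (shift-inverseˡ s u)) (trans (cong (shift (⊖ s)) eq) (shift-inverseˡ s v))

  shift-comm : ∀ s t u → shift s (shift t u) ≡ shift t (shift s u)
  shift-comm s t u = trans (shift-shift s t u) (trans (cong (λ x → shift x u) (⊕-comm t s))
    (sym (shift-shift t s u)))

  -- From the label triple to the ladder.

  module _ (connected : ∀ u v → Star _~_ u v) (G≇K4 : ¬ (G ≅ K 4))
           {h a : Fin n} (T : IsChordalTriple labels h a) where

    open IsChordalTriple T

    ∈labels : ∀ {s} → s ∈ h ∷ a ∷ ⊖ a ∷ [] → s ∈ labels
    ∈labels = ∈-resp-↭ (↭-sym S↭)

    -- The neighbours of `u` are its shifts by the three labels; a label `⊖ a` at `u` is read from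
    -- `v`, where it is `a`.
    adjacent⇔ : ∀ {u v} → u ~ v ⇔ (v ≡ shift h u ⊎ v ≡ shift a u ⊎ u ≡ shift a v)
    adjacent⇔ {u} {v} = mk⇔ to from
      where
      to : u ~ v → v ≡ shift h u ⊎ v ≡ shift a u ⊎ u ≡ shift a v
      to u~v with ∈-resp-↭ S↭ (label∈labels u~v)
      ... | here eq                 = inj₁ (label⇒shift eq)
      ... | there (here eq)         = inj₂ (inj₁ (label⇒shift eq))
      ... | there (there (here eq)) = inj₂ (inj₂ (label⇒shift
        (trans (label-sym u v) (trans (cong ⊖_ eq) (⁻¹-involutive a)))))

      from : v ≡ shift h u ⊎ v ≡ shift a u ⊎ u ≡ shift a v → u ~ v
      from (inj₁ refl)        = shift-~ (∈labels (here refl)) u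
      from (inj₂ (inj₁ refl)) = shift-~ (∈labels (there (here refl))) u
      from (inj₂ (inj₂ refl)) = Graph.sym G (shift-~ (∈labels (there (here refl))) v)

    -- `⊖h≡h` makes `shift h` an involution and `0∉labels` makes it fixed-point free; `⊖a≢a`
    -- excludes 2-cycles of `shift a`, and `h≢a` keeps the shifts apart.
    open Ladder G (shift a) (shift h) (shift-injective a)
      (λ v → shift (⊖ a) v , shift-inverseʳ a v)
      (λ u → trans (cong (λ s → shift s (shift h u)) (sym ⊖h≡h)) (shift-inverseˡ h u))
      (shift-comm a h)
      (λ u eq → ⊖a≢a (sym (inverseˡ-unique a a (shift-fixed (trans (sym (shift-shift a a u)) eq)))))
      (λ u eq → 0∉labels (subst (_∈ labels) (shift-fixed eq) (∈labels (here refl))))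
      (λ u eq → h≢a (sym (shift-injectiveˡ eq)))
      adjacent⇔

    triple⇒has6CDC : Has6CDC G
    triple⇒has6CDC = by-cases (a ⊕ a Fin.≟ h)
      where
      by-cases : Dec (a ⊕ a ≡ h) → Has6CDC G
      -- Here `shift a` squares to `shift h`, which forces K₄; `0#` supplies the starting vertex.
      by-cases (yes a⊕a≡h) = contradiction
        (Collapsed.≅K4 connected (λ u → trans (shift-shift a a u) (cong (λ s → shift s u) a⊕a≡h)) 0#) G≇K4
      by-cases (no a⊕a≢h) = Proper.has6CDC
        (λ u eq → a⊕a≢h (shift-injectiveˡ (trans (sym (shift-shift a a u)) eq)))

  has6CDC : (∀ u v → Star _~_ u v) → ¬ (G ≅ K 4) → Has6CDC G
  has6CDC connected G≇K4 =
    let _ , _ , T = chordalTriple (deduplicate-! Fin._≟_ (allLabels G r))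
                      (trans minimal maxDegree≡3) 0∉labels labels-⊖
    in triple⇒has6CDC connected G≇K4 T

theorem10 : ∀ (n : ℕ) (G : Graph n) → Connected G → Cubic G →
    HasMCSD G → ¬ (G ≅ K 4) → Has6CDC G
theorem10 n G (nonZero , connected) cubic (r , minimal) G≇K4 =
  Labels.has6CDC G {{nonZero}} cubic r minimal connected G≇K4
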